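{- For any integer $\gamma \geq 0$, $\mathsf{Dias}_\gamma$ is a nontrivially rooted operad for the root map sending any word of $\mathsf{Dias}_\gamma$ to the position of its $0$.
   Context: Write $[\gamma] = \{1, \dots, \gamma\}$ (empty if $\gamma = 0$). A set-operad is a nonsymmetric operad in sets, described by partial compositions $\circ_i$ and a unit. $\mathsf{Dias}_\gamma$ is the set-operad generated by the two-letter words $0a$ and $a0$, $a \in [\gamma]$, inside the set-operad $\mathsf{T}\mathcal{M}_\gamma$ whose elements of arity $n \ge 1$ are all words of length $n$ on $\{0\} \cup [\gamma]$, with partial compositions $u \circ_i v := u_1 \dots u_{i-1}\,\max(u_i, v_1) \dots \max(u_i, v_m)\, u_{i+1} \dots u_n$ (for $u$ of length $n$, $v$ of length $m$, $1 \le i \le n$) and unit the word $0$. Every word of $\mathsf{Dias}_\gamma$ contains exactly one $0$. An operad $\mathcal{O}$ is rooted if there is a root map, that is, a map $\mathrm{root} : \mathcal{O}(n) \to \{1,\dots,n\}$, $n \geq 1$, such that for all $x \in \mathcal{O}(n)$, $y \in \mathcal{O}(m)$, $1 \le i \le n$: $\mathrm{root}(x \circ_i y) = \mathrm{root}(x) + m - 1$ if $i \leq \mathrm{root}(x) - 1$; $\mathrm{root}(x \circ_i y) = \mathrm{root}(x) + \mathrm{root}(y) - 1$ if $i = \mathrm{root}(x)$; and $\mathrm{root}(x \circ_i y) = \mathrm{root}(x)$ if $i \geq \mathrm{root}(x) + 1$. Any operad is rooted for the root maps $\mathrm{root}_{\mathrm{L}}$ and $\mathrm{root}_{\mathrm{R}}$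 sending every element of arity $n$ to $1$, respectively to $n$. An operad is nontrivially rooted if it can be endowed with a root map different from $\mathrm{root}_{\mathrm{L}}$ and $\mathrm{root}_{\mathrm{R}}$; it is nontrivially rooted for a given root map if that root map is different from these two.
   Formalization: Nontriviality is asserted only for γ ≥ 1: for γ = 0 the operad Dias_0 consists of its unit alone, where every root map equals root_L and root_R, so the claim fails; that the position of the 0 is a root map is still proved for all γ ≥ 0. -}

module Defs where

open import Data.Empty using (⊥-elim)
open import Data.Fin.Base as Fin using (Fin; zero; suc; toℕ; fromℕ)
import Data.Fin.Properties as Fin
open import Data.Irrelevant as Irrelevant using ([_])
open import Data.List.Base as List using (List; []; _∷_; _++_; length)
import Data.List.Properties as List
open import Data.List.Relation.Unary.All as All using (All; []; _∷_)
import Data.List.Relation.Unary.All.Properties as All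
open import Data.Nat.Base using (ℕ; zero; suc; _+_; _<_; z≤n; s≤s)
import Data.Nat.Properties as ℕ
open import Data.Product using (_,_; proj₁; ∃!)
open import Data.Refinement.Base using (Refinement-syntax; value; proof; _,_)
open import Data.Vec.Base as Vec using (Vec; []; _∷_; lookup; toList)
import Data.Vec.Properties as Vec
open import Level using (Level) renaming (suc to lsuc)
open import Relation.Binary.PropositionalEquality
  using (_≡_; _≢_; refl; sym; trans; cong; cong₂; subst; module ≡-Reasoning)
open import Relation.Nullary using (¬_; Dec; yes; no; ¬?; recompute)

import Algebra.Construct.NaturalChoice.Max as Max
open import Algebra.Properties.CommutativeSemigroup ℕ.+-commutativeSemigroup
  using (xy∙z≈xz∙y)

private
  variable
    ℓ : Level
    m n p γ : ℕ

-- `Op n` is the set of elements of arity `suc n`, so that there is nothing in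
-- arity 0.  Positions are counted from 0: the composition x ∘ᵢ y of the
-- literature is `x ∘⟨ i - 1 ⟩ y`.  Composite positions are given by their
-- values in ℕ instead of by casts between `Fin` types.
record SetOperad (ℓ : Level) : Set (lsuc ℓ) where
  infixl 7 _∘⟨_⟩_
  field
    Op     : ℕ → Set ℓ
    𝟙      : Op 0
    _∘⟨_⟩_ : Op m → Fin (suc m) → Op n → Op (m + n)

    identityˡ : (x : Op n) → 𝟙 ∘⟨ zero ⟩ x ≡ x
    identityʳ : (x : Op n) (i : Fin (suc n)) →
                subst Op (ℕ.+-identityʳ n) (x ∘⟨ i ⟩ 𝟙) ≡ x
    -- (x ∘ᵢ y) ∘ᵢ₊ⱼ₋₁ z = x ∘ᵢ (y ∘ⱼ z)
    sequential : (x : Op m) (y : Op n) (z : Op p)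
                 (i : Fin (suc m)) (j : Fin (suc n)) (k : Fin (suc (m + n))) →
                 toℕ k ≡ toℕ i + toℕ j →
                 subst Op (ℕ.+-assoc m n p) (x ∘⟨ i ⟩ y ∘⟨ k ⟩ z)
                   ≡ x ∘⟨ i ⟩ (y ∘⟨ j ⟩ z)
    -- (x ∘ᵢ y) ∘ⱼ₊|y|₋₁ z = (x ∘ⱼ z) ∘ᵢ y for i < j
    parallel : (x : Op m) (y : Op n) (z : Op p)
               (i j : Fin (suc m)) (k : Fin (suc (m + n))) (l : Fin (suc (m + p))) →
               toℕ i < toℕ j → toℕ k ≡ toℕ j + n → toℕ l ≡ toℕ i →
               subst Op (xy∙z≈xz∙y m n p) (x ∘⟨ i ⟩ y ∘⟨ k ⟩ z)
                 ≡ x ∘⟨ j ⟩ z ∘⟨ l ⟩ y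

module _ (O : SetOperad ℓ) where
  open SetOperad O

  RootFunction : Set ℓ
  RootFunction = ∀ {n} → Op n → Fin (suc n)

  -- With 0-based positions and y of arity suc n, the shift by the arity of y
  -- minus 1 is n, and root(x) + root(y) - 1 becomes a plain sum.
  record IsRootMap (root : RootFunction) : Set ℓ where
    field
      root-< : (x : Op m) (y : Op n) (i : Fin (suc m)) → i Fin.< root x →
               toℕ (root (x ∘⟨ i ⟩ y)) ≡ toℕ (root x) + n
      root-≡ : (x : Op m) (y : Op n) (i : Fin (suc m)) → i ≡ root x →
               toℕ (root (x ∘⟨ i ⟩ y)) ≡ toℕ (root x) + toℕ (root y)
      root-> : (x : Op m) (y : Op n) (i : Fin (suc m)) → root x Fin.< i →
               toℕ (root (x ∘⟨ i ⟩ y)) ≡ toℕ (root x)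

  rootL : RootFunction
  rootL _ = zero

  rootR : RootFunction
  rootR {n} _ = fromℕ n

  record IsNontrivialRootMap (root : RootFunction) : Set ℓ where
    field
      isRootMap : IsRootMap root
      ≢rootL    : ¬ (∀ {n} (x : Op n) → root x ≡ rootL x)
      ≢rootR    : ¬ (∀ {n} (x : Op n) → root x ≡ rootR x)

module _ (O : SetOperad ℓ) (G : ∀ {n} → SetOperad.Op O n → Set) where
  open SetOperad O

  data Generated : ∀ {n} → Op n → Set ℓ where
    generator   : {x : Op n} → G x → Generated x
    unit        : Generated 𝟙
    composition : {x : Op m} {y : Op n} (i : Fin (suc m)) →
                  Generated x → Generated y → Generated (x ∘⟨ i ⟩ y)

  private
    Op′ : ℕ → Set ℓ
    Op′ n = [ x ∈ Op n ∣ Generated x ]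

    value-injective : {x y : Op′ n} → value x ≡ value y → x ≡ y
    value-injective refl = refl

    subst-value-injective : (e : m ≡ n) {x : Op′ m} {y : Op′ n} →
                            subst Op e (value x) ≡ value y → subst Op′ e x ≡ y
    subst-value-injective refl = value-injective

  -- Membership is a proof-irrelevant field, so elements of the suboperad are
  -- equal exactly when they are equal in O.
  generatedSuboperad : SetOperad ℓ
  generatedSuboperad = record
    { Op         = Op′
    ; 𝟙          = 𝟙 , [ unit ]
    ; _∘⟨_⟩_     = λ x i y → value x ∘⟨ i ⟩ value y
                           , Irrelevant.zipWith (composition i) (proof x) (proof y)
    ; identityˡ  = λ x → value-injective (identityˡ (value x))
    ; identityʳ  = λ {n} x i →
        subst-value-injective (ℕ.+-identityʳ n) (identityʳ (value x) i)
    ; sequential = λ {m} {n} {p} x y z i j k e →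
        subst-value-injective (ℕ.+-assoc m n p)
          (sequential (value x) (value y) (value z) i j k e)
    ; parallel   = λ {m} {n} {p} x y z i j k l i<j e f →
        subst-value-injective (xy∙z≈xz∙y m n p)
          (parallel (value x) (value y) (value z) i j k l i<j e f)
    }

-- The letters are {0} ∪ [γ]; the element a of [γ] is `suc` of a position
-- in `Fin γ`.
Letter : ℕ → Set
Letter γ = Fin (suc γ)

module _ {γ : ℕ} where
  open Max (Fin.≤-totalOrder (suc γ)) public
    using (_⊔_; ⊔-assoc; ⊔-identityʳ; x≤y⇒x⊔y≈y; x≤x⊔y)

Word : ℕ → ℕ → Set
Word γ n = Vec (Letter γ) (suc n)

infixl 7 _∘ʷ⟨_⟩_
_∘ʷ⟨_⟩_ : Word γ m → Fin (suc m) → Word γ n → Word γ (m + n)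
_∘ʷ⟨_⟩_ {m = m} {n = n} (a ∷ u) zero v =
  Vec.cast (cong suc (ℕ.+-comm n m)) (Vec.map (a ⊔_) v Vec.++ u)
_∘ʷ⟨_⟩_ {m = suc m} (a ∷ u) (suc i) v = a ∷ (u ∘ʷ⟨ i ⟩ v)

-- The operad axioms are proved on underlying lists, where no casts occur.
graft : List (Letter γ) → ℕ → List (Letter γ) → List (Letter γ)
graft []      _       v = []
graft (a ∷ u) zero    v = List.map (a ⊔_) v ++ u
graft (a ∷ u) (suc i) v = a ∷ graft u i v

toList-∘ʷ : (u : Word γ m) (i : Fin (suc m)) (v : Word γ n) →
            toList (u ∘ʷ⟨ i ⟩ v) ≡ graft (toList u) (toℕ i) (toList v)
toList-∘ʷ (a ∷ u) zero v =
  trans (Vec.toList-cast _ (Vec.map (a ⊔_) v Vec.++ u))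
  (trans (Vec.toList-++ (Vec.map (a ⊔_) v) u)
         (cong (_++ toList u) (Vec.toList-map (a ⊔_) v)))
toList-∘ʷ {m = suc m} (a ∷ u) (suc i) v = cong (a ∷_) (toList-∘ʷ u i v)

0⊔ : (a : Letter γ) → zero ⊔ a ≡ a
0⊔ a = x≤y⇒x⊔y≈y z≤n

⊔0 : (a : Letter γ) → a ⊔ zero ≡ a
⊔0 = ⊔-identityʳ (λ _ → z≤n)

map-0⊔ : (v : List (Letter γ)) → List.map (zero ⊔_) v ≡ v
map-0⊔ v = trans (List.map-cong 0⊔ v) (List.map-id v)

graft-unit : (u : List (Letter γ)) (i : ℕ) → graft u i (zero ∷ []) ≡ u
graft-unit []      i       = refl
graft-unit (a ∷ u) zero    = cong (_∷ u) (⊔0 a)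
graft-unit (a ∷ u) (suc i) = cong (a ∷_) (graft-unit u i)

graft-map : (a : Letter γ) (u : List (Letter γ)) (i : ℕ) (v : List (Letter γ)) →
             graft (List.map (a ⊔_) u) i v ≡ List.map (a ⊔_) (graft u i v)
graft-map a []      i       v = refl
graft-map a (b ∷ u) (suc i) v = cong ((a ⊔ b) ∷_) (graft-map a u i v)
graft-map a (b ∷ u) zero    v = begin
  List.map ((a ⊔ b) ⊔_) v ++ List.map (a ⊔_) u
    ≡⟨ cong (_++ _) (List.map-cong (⊔-assoc a b) v) ⟩
  List.map (λ c → a ⊔ (b ⊔ c)) v ++ List.map (a ⊔_) u
    ≡⟨ cong (_++ _) (List.map-∘ v) ⟩
  List.map (a ⊔_) (List.map (b ⊔_) v) ++ List.map (a ⊔_) u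
    ≡⟨ List.map-++ (a ⊔_) (List.map (b ⊔_) v) u ⟨
  List.map (a ⊔_) (List.map (b ⊔_) v ++ u) ∎
  where open ≡-Reasoning

graft-++ˡ : (u w : List (Letter γ)) (i : ℕ) (v : List (Letter γ)) →
             i < length u → graft (u ++ w) i v ≡ graft u i v ++ w
graft-++ˡ (a ∷ u) w zero    v _       = sym (List.++-assoc (List.map (a ⊔_) v) u w)
graft-++ˡ (a ∷ u) w (suc i) v (s≤s p) = cong (a ∷_) (graft-++ˡ u w i v p)

graft-++ʳ : (u w : List (Letter γ)) (i : ℕ) (v : List (Letter γ)) →
             graft (u ++ w) (length u + i) v ≡ u ++ graft w i v
graft-++ʳ []      w i v = refl
graft-++ʳ (a ∷ u) w i v = cong (a ∷_) (graft-++ʳ u w i v)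

graft-sequential : (u : List (Letter γ)) (i : ℕ) (v : List (Letter γ)) (j : ℕ)
                    (w : List (Letter γ)) → j < length v →
                    graft (graft u i v) (i + j) w ≡ graft u i (graft v j w)
graft-sequential []      i       v j w _ = refl
graft-sequential (a ∷ u) (suc i) v j w p =
  cong (a ∷_) (graft-sequential u i v j w p)
graft-sequential (a ∷ u) zero    v j w p =
  trans (graft-++ˡ (List.map (a ⊔_) v) u j w
          (subst (j <_) (sym (List.length-map (a ⊔_) v)) p))
        (cong (_++ u) (graft-map a v j w))

graft-parallel : (u : List (Letter γ)) (i j : ℕ) (v : List (Letter γ))
                  (w : List (Letter γ)) → i < j → length v ≡ suc n →
                  graft (graft u i v) (j + n) w ≡ graft (graft u j w) i v
graft-parallel []      i       j       v w _       _ = refl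
graft-parallel (a ∷ u) (suc i) (suc j) v w (s≤s p) e =
  cong (a ∷_) (graft-parallel u i j v w p e)
graft-parallel {n = n} (a ∷ u) zero (suc j) v w _  e =
  trans (cong (λ t → graft (List.map (a ⊔_) v ++ u) t w) shift)
        (graft-++ʳ (List.map (a ⊔_) v) u j w)
  where
  shift : suc (j + n) ≡ length (List.map (a ⊔_) v) + j
  shift = trans (cong suc (ℕ.+-comm j n))
                (cong (_+ j) (sym (trans (List.length-map (a ⊔_) v) e)))

≡-toList : (u v : Word γ n) → toList u ≡ toList v → u ≡ v
≡-toList u v e =
  trans (sym (Vec.cast-is-id refl u)) (Vec.toList-injective refl u v e)

subst-toList : (e : m ≡ n) (u : Word γ m) (v : Word γ n) →
               toList u ≡ toList v → subst (Word γ) e u ≡ v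
subst-toList refl = ≡-toList

toList-∘ʷ∘ʷ : (u : Word γ m) (i : Fin (suc m)) (v : Word γ n)
              (k : Fin (suc (m + n))) (w : Word γ p) →
              toList (u ∘ʷ⟨ i ⟩ v ∘ʷ⟨ k ⟩ w) ≡
              graft (graft (toList u) (toℕ i) (toList v)) (toℕ k) (toList w)
toList-∘ʷ∘ʷ u i v k w =
  trans (toList-∘ʷ (u ∘ʷ⟨ i ⟩ v) k w)
        (cong (λ t → graft t (toℕ k) (toList w)) (toList-∘ʷ u i v))

TM : ℕ → SetOperad _
TM γ = record
  { Op         = Word γ
  ; 𝟙          = zero ∷ []
  ; _∘⟨_⟩_     = _∘ʷ⟨_⟩_
  ; identityˡ  = λ x → ≡-toList _ x
      (trans (toList-∘ʷ (zero ∷ []) zero x)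
      (trans (List.++-identityʳ _) (map-0⊔ (toList x))))
  ; identityʳ  = λ {n} x i → subst-toList (ℕ.+-identityʳ n) _ x
      (trans (toList-∘ʷ x i (zero ∷ [])) (graft-unit (toList x) (toℕ i)))
  ; sequential = λ {m} {n} {p} x y z i j k e → subst-toList (ℕ.+-assoc m n p) _ _
      (begin
        toList (x ∘ʷ⟨ i ⟩ y ∘ʷ⟨ k ⟩ z)
          ≡⟨ toList-∘ʷ∘ʷ x i y k z ⟩
        graft (graft (toList x) (toℕ i) (toList y)) (toℕ k) (toList z)
          ≡⟨ cong (λ t → graft (graft (toList x) (toℕ i) (toList y)) t (toList z)) e ⟩
        graft (graft (toList x) (toℕ i) (toList y)) (toℕ i + toℕ j) (toList z)
          ≡⟨ graft-sequential (toList x) (toℕ i) (toList y) (toℕ j) (toList z)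
               (subst (toℕ j <_) (sym (Vec.length-toList y)) (Fin.toℕ<n j)) ⟩
        graft (toList x) (toℕ i) (graft (toList y) (toℕ j) (toList z))
          ≡⟨ cong (graft (toList x) (toℕ i)) (toList-∘ʷ y j z) ⟨
        graft (toList x) (toℕ i) (toList (y ∘ʷ⟨ j ⟩ z))
          ≡⟨ toList-∘ʷ x i (y ∘ʷ⟨ j ⟩ z) ⟨
        toList (x ∘ʷ⟨ i ⟩ (y ∘ʷ⟨ j ⟩ z)) ∎)
  ; parallel   = λ {m} {n} {p} x y z i j k l i<j e f →
      subst-toList (xy∙z≈xz∙y m n p) _ _
      (begin
        toList (x ∘ʷ⟨ i ⟩ y ∘ʷ⟨ k ⟩ z)
          ≡⟨ toList-∘ʷ∘ʷ x i y k z ⟩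
        graft (graft (toList x) (toℕ i) (toList y)) (toℕ k) (toList z)
          ≡⟨ cong (λ t → graft (graft (toList x) (toℕ i) (toList y)) t (toList z)) e ⟩
        graft (graft (toList x) (toℕ i) (toList y)) (toℕ j + n) (toList z)
          ≡⟨ graft-parallel (toList x) (toℕ i) (toℕ j) (toList y) (toList z)
               i<j (Vec.length-toList y) ⟩
        graft (graft (toList x) (toℕ j) (toList z)) (toℕ i) (toList y)
          ≡⟨ cong (λ t → graft (graft (toList x) (toℕ j) (toList z)) t (toList y)) f ⟨
        graft (graft (toList x) (toℕ j) (toList z)) (toℕ l) (toList y)
          ≡⟨ toList-∘ʷ∘ʷ x j z l y ⟨
        toList (x ∘ʷ⟨ j ⟩ z ∘ʷ⟨ l ⟩ y) ∎)
  }
  where open ≡-Reasoning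

data DiasGenerator {γ : ℕ} : ∀ {n} → Word γ n → Set where
  0a : (a : Fin γ) → DiasGenerator (zero ∷ suc a ∷ [])
  a0 : (a : Fin γ) → DiasGenerator (suc a ∷ zero ∷ [])

Dias : ℕ → SetOperad _
Dias γ = generatedSuboperad (TM γ) DiasGenerator

data OneZero {γ : ℕ} : List (Letter γ) → Set where
  here  : ∀ {u} → All (_≢ zero) u → OneZero (zero ∷ u)
  there : ∀ {a u} → a ≢ zero → OneZero u → OneZero (a ∷ u)

oneZero? : (u : List (Letter γ)) → Dec (OneZero u)
oneZero? [] = no λ ()
oneZero? (zero ∷ u) with All.all? (λ a → ¬? (a Fin.≟ zero)) u
... | yes p = yes (here p)
... | no ¬p = no λ { (here p) → ¬p p ; (there 0≢0 _) → 0≢0 refl }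
oneZero? (suc a ∷ u) with oneZero? u
... | yes p = yes (there (λ ()) p)
... | no ¬p = no λ { (there _ p) → ¬p p }

⊔≢0 : {a : Letter γ} → a ≢ zero → (b : Letter γ) → a ⊔ b ≢ zero
⊔≢0 {a = zero}  a≢0 b _ = a≢0 refl
⊔≢0 {a = suc a} _   b e with () ← subst (suc a Fin.≤_) e (x≤x⊔y (suc a) b)

map-⊔≢0 : {a : Letter γ} → a ≢ zero → (v : List (Letter γ)) →
          All (_≢ zero) (List.map (a ⊔_) v)
map-⊔≢0 a≢0 v = All.map⁺ (All.universal (⊔≢0 a≢0) v)

noZero-graft : {u : List (Letter γ)} → All (_≢ zero) u → (i : ℕ) →
                (v : List (Letter γ)) → All (_≢ zero) (graft u i v)
noZero-graft []       i       v = []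
noZero-graft (p ∷ ps) zero    v = All.++⁺ (map-⊔≢0 p v) ps
noZero-graft (p ∷ ps) (suc i) v = p ∷ noZero-graft ps i v

oneZero-++ˡ : {u v : List (Letter γ)} → OneZero u → All (_≢ zero) v → OneZero (u ++ v)
oneZero-++ˡ (here ps)   qs = here (All.++⁺ ps qs)
oneZero-++ˡ (there p o) qs = there p (oneZero-++ˡ o qs)

oneZero-++ʳ : {u v : List (Letter γ)} → All (_≢ zero) u → OneZero v → OneZero (u ++ v)
oneZero-++ʳ []       o = o
oneZero-++ʳ (p ∷ ps) o = there p (oneZero-++ʳ ps o)

oneZero-graft : {u v : List (Letter γ)} → OneZero u → (i : ℕ) → OneZero v →
                 OneZero (graft u i v)
oneZero-graft (here ps) zero o =
  oneZero-++ˡ (subst OneZero (sym (map-0⊔ _)) o) ps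
oneZero-graft (here ps)   (suc i) o = here (noZero-graft ps i _)
oneZero-graft (there p q) zero    o = oneZero-++ʳ (map-⊔≢0 p _) q
oneZero-graft (there p q) (suc i) o = there p (oneZero-graft q i o)

generated⇒oneZero : {u : Word γ n} → Generated (TM γ) DiasGenerator u →
                    OneZero (toList u)
generated⇒oneZero (generator (0a a)) = here ((λ ()) ∷ [])
generated⇒oneZero (generator (a0 a)) = there (λ ()) (here [])
generated⇒oneZero unit               = here []
generated⇒oneZero (composition {x = u} {y = v} i p q) =
  subst OneZero (sym (toList-∘ʷ u i v))
    (oneZero-graft (generated⇒oneZero p) (toℕ i) (generated⇒oneZero q))

lookup≢0 : (u : Vec (Letter γ) n) → All (_≢ zero) (toList u) → (i : Fin n) →
           lookup u i ≢ zero
lookup≢0 (a ∷ u) (p ∷ ps) zero    = p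
lookup≢0 (a ∷ u) (p ∷ ps) (suc i) = lookup≢0 u ps i

oneZero⇒∃! : (u : Vec (Letter γ) n) → OneZero (toList u) →
             ∃! _≡_ (λ i → lookup u i ≡ zero)
oneZero⇒∃! (zero ∷ u) (here ps) = zero , refl , unique
  where
  unique : ∀ {i} → lookup (zero ∷ u) i ≡ zero → zero ≡ i
  unique {zero}  _ = refl
  unique {suc i} e = ⊥-elim (lookup≢0 u ps i e)
oneZero⇒∃! (a ∷ u) (there p o) with oneZero⇒∃! u o
... | i , e , unique = suc i , e , unique′
  where
  unique′ : ∀ {j} → lookup (a ∷ u) j ≡ zero → suc i ≡ j
  unique′ {zero}  e = ⊥-elim (p e)
  unique′ {suc j} e = cong suc (unique e)

uniqueZero : (x : SetOperad.Op (Dias γ) n) →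
             ∃! _≡_ (λ i → lookup (value x) i ≡ zero)
uniqueZero (u , [ g ]) =
  oneZero⇒∃! u (recompute (oneZero? (toList u)) (generated⇒oneZero g))

zeroPosition : (γ : ℕ) → RootFunction (Dias γ)
zeroPosition γ x = proj₁ (uniqueZero x)

-- There are no generators when γ = 0: Dias₀ consists of its unit alone, and
-- all functions Op n → Fin (suc n) on it agree.
Dias₀-trivially-rooted : (root : RootFunction (Dias 0)) →
                         ¬ IsNontrivialRootMap (Dias 0) root
Dias₀-trivially-rooted root r = IsNontrivialRootMap.≢rootL r ≡rootL
  where
  arity : {u : Word 0 n} → Generated (TM 0) DiasGenerator u → n ≡ 0
  arity (generator (0a ()))
  arity (generator (a0 ()))
  arity unit = refl
  arity (composition i p q) = cong₂ _+_ (arity p) (arity q)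

  Fin1 : n ≡ 0 → (i : Fin (suc n)) → i ≡ zero
  Fin1 refl zero = refl

  ≡rootL : ∀ {n} (x : SetOperad.Op (Dias 0) n) → root x ≡ zero
  ≡rootL {n} x@(u , [ g ]) = Fin1 (recompute (n ℕ.≟ 0) (arity g)) (root x)

{-# OPTIONS --safe #-}

-- The zero of x ∘ᵢ y descends from the zero of x unless i is its position.  In
-- that case y is copied unchanged, as 0 is neutral for max, and the zero is
-- that of y.  Since the zero of a word is unique, it suffices to exhibit one at
-- the position claimed.

module Submission where

open import Defs
open import Data.Nat.Base using (ℕ; _≥_)
open import Data.Product.Base using (_×_)

open import Data.Fin.Base using (Fin; zero; suc; toℕ)
import Data.Fin.Properties as Fin
open import Data.Irrelevant using ([_])
open import Data.List.Base as List using (List; []; _∷_; _++_; length)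
import Data.List.Properties as List
open import Data.Nat.Base using (suc; zero; _+_; _<_; s≤s)
import Data.Nat.Properties as ℕ
open import Data.Product.Base using (_,_; proj₁; proj₂; ∃-syntax)
open import Data.Refinement.Base using (value; _,_)
open import Data.Vec.Base using (Vec; _∷_; lookup; toList)
import Data.Vec.Properties as Vec
open import Relation.Binary.PropositionalEquality
  using (_≡_; refl; sym; trans; cong; subst)

private
  variable
    m n k l i γ : ℕ
    u v w : List (Letter γ)

-- Indices in ℕ on lists match `graft`, so shifted positions are plain sums without casts.
-- Uniqueness is left to `uniqueZero`.
data ZeroAt {γ : ℕ} : ℕ → List (Letter γ) → Set where
  here  : ZeroAt 0 (zero ∷ u)
  there : ∀ {a} → ZeroAt k u → ZeroAt (suc k) (a ∷ u)

zeroAt-++ˡ : ZeroAt k u → ZeroAt k (u ++ w)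
zeroAt-++ˡ here      = here
zeroAt-++ˡ (there z) = there (zeroAt-++ˡ z)

zeroAt-++ʳ : (w : List (Letter γ)) → ZeroAt k u → ZeroAt (length w + k) (w ++ u)
zeroAt-++ʳ []      z = z
zeroAt-++ʳ (_ ∷ w) z = there (zeroAt-++ʳ w z)

-- Grafting trades the letter at `i` for `suc n` letters, so each later letter moves right by `n`,
-- its value intact.
zeroAt-graft-< : ZeroAt k u → i < k → length v ≡ suc n → ZeroAt (k + n) (graft u i v)
zeroAt-graft-< {i = suc i} (there z) (s≤s i<k) e = there (zeroAt-graft-< z i<k e)
zeroAt-graft-< {i = zero} {v = v} {n = n} (there {k = k} {u = u} {a = a} z) _ e =
  subst (λ t → ZeroAt t (List.map (a ⊔_) v ++ u)) shift (zeroAt-++ʳ (List.map (a ⊔_) v) z)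
  where
  -- The `suc` of `suc k` counted `a`; it now comes from the block of `suc n` letters put in place
  -- of `a`.
  shift : length (List.map (a ⊔_) v) + k ≡ suc k + n
  shift = trans (cong (_+ k) (trans (List.length-map (a ⊔_) v) e))
                (cong suc (ℕ.+-comm n k))

zeroAt-graft-≡ : ZeroAt k u → ZeroAt l v → ZeroAt (k + l) (graft u k v)
zeroAt-graft-≡ here      y = zeroAt-++ˡ (subst (ZeroAt _) (sym (map-0⊔ _)) y)
zeroAt-graft-≡ (there z) y = there (zeroAt-graft-≡ z y)

-- `graft` copies the letters before index `i`, and this zero is one of them.
zeroAt-graft-> : ZeroAt k u → k < i → ZeroAt k (graft u i v)
zeroAt-graft-> {i = suc i} here      _         = here
zeroAt-graft-> {i = suc i} (there z) (s≤s k<i) = there (zeroAt-graft-> z k<i)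

lookup⇒zeroAt : (u : Vec (Letter γ) n) (j : Fin n) → lookup u j ≡ zero →
                ZeroAt (toℕ j) (toList u)
lookup⇒zeroAt (_ ∷ u) zero    refl = here
lookup⇒zeroAt (_ ∷ u) (suc j) e    = there (lookup⇒zeroAt u j e)

zeroAt⇒lookup : (u : Vec (Letter γ) n) → ZeroAt k (toList u) →
                ∃[ j ] toℕ j ≡ k × lookup u j ≡ zero
zeroAt⇒lookup (_ ∷ u) here      = zero , refl , refl
zeroAt⇒lookup (_ ∷ u) (there z) with zeroAt⇒lookup u z
... | j , refl , e = suc j , refl , e

zeroAt-zeroPosition : (x : SetOperad.Op (Dias γ) n) →
                      ZeroAt (toℕ (zeroPosition γ x)) (toList (value x))
zeroAt-zeroPosition x =
  lookup⇒zeroAt (value x) _ (proj₁ (proj₂ (uniqueZero x)))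

zeroPosition-unique : (x : SetOperad.Op (Dias γ) n) → ZeroAt k (toList (value x)) →
                      toℕ (zeroPosition γ x) ≡ k
zeroPosition-unique x z with zeroAt⇒lookup (value x) z
... | _ , refl , e = cong toℕ (proj₂ (proj₂ (uniqueZero x)) e)

module _ {γ : ℕ} where
  open SetOperad (Dias γ)

  -- Reduces each root equation to a `ZeroAt` witness in the grafted list, which `toList-∘ʷ` carries
  -- over to the composite word.
  zeroPosition-∘ : (x : Op m) (i : Fin (suc m)) (y : Op n) →
                   ZeroAt k (graft (toList (value x)) (toℕ i) (toList (value y))) →
                   toℕ (zeroPosition γ (x ∘⟨ i ⟩ y)) ≡ k
  zeroPosition-∘ x i y z = zeroPosition-unique (x ∘⟨ i ⟩ y)
    (subst (ZeroAt _) (sym (toList-∘ʷ (value x) i (value y))) z)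

zeroPosition-isRootMap : (γ : ℕ) → IsRootMap (Dias γ) (zeroPosition γ)
zeroPosition-isRootMap γ = record
  { root-< = λ x y i i<r → zeroPosition-∘ x i y
      (zeroAt-graft-< (zeroAt-zeroPosition x) i<r (Vec.length-toList (value y)))
  ; root-≡ = λ { x y _ refl → zeroPosition-∘ x _ y
      (zeroAt-graft-≡ (zeroAt-zeroPosition x) (zeroAt-zeroPosition y)) }
  ; root-> = λ x y i r<i → zeroPosition-∘ x i y
      (zeroAt-graft-> (zeroAt-zeroPosition x) r<i)
  }

-- Nontriviality asks for `γ ≥ 1`: `Dias 0` consists of its unit alone, and `Dias₀-trivially-rooted`
-- excludes it.
proposition2p3p4 : (γ : ℕ) →
    IsRootMap (Dias γ) (zeroPosition γ) ×
    (γ ≥ 1 → IsNontrivialRootMap (Dias γ) (zeroPosition γ))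
proposition2p3p4 γ = zeroPosition-isRootMap γ , nontrivial
  where
  nontrivial : γ ≥ 1 → IsNontrivialRootMap (Dias γ) (zeroPosition γ)
  nontrivial (s≤s _) = record
    { isRootMap = zeroPosition-isRootMap γ
    -- As `γ` is a successor, the letter `suc zero` exists. The zero of `a0 zero` has index 1 where
    -- `rootL` gives 0; that of `0a zero` has index 0 where `rootR` gives 1. Both indices compute,
    -- since `recompute` runs `oneZero?`.
    ; ≢rootL    = λ ≡rootL → Fin.0≢1+n (sym (≡rootL (_ , [ generator (a0 zero) ])))
    ; ≢rootR    = λ ≡rootR → Fin.0≢1+n (≡rootR (_ , [ generator (0a zero) ]))
    }
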